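{- Every $k$-tunnel gadget that is reversible, deterministic, and has interacting tunnels simulates a locking 2-toggle.
   Context: A gadget consists of finitely many locations and finitely many states; each state $s$ has a set of transitions $(a,b,s')$ meaning a robot may enter at location $a$, exit at location $b$, and the gadget's state becomes $s'$. The transition graph is the directed graph on state/location pairs with an edge $(s,a)\to(s',b)$ for each transition. A $k$-tunnel gadget has $2k$ locations partitioned into $k$ pairs called tunnels, and every transition goes between the two locations of one tunnel. It has interacting tunnels if some transition across a tunnel from a state $s$ to a state $s'$ changes the set of allowed traversal directions of some other tunnel. It is deterministic if the transition graph has out-degree at most 1, and reversible if the reverse of every transition-graph edge is also an edge. The locking 2-toggle is the 2-tunnel gadget with tunnels $\{a_1,b_1\}$ and $\{a_2,b_2\}$ and three states $M,S_1,S_2$: in $M$ the only transitions are $a_1\to b_1$ (to $S_1$) and $a_2\to b_2$ (to $S_2$); in $S_i$ the only transition is $b_i\to a_i$ (back to $M$). A system of gadgets consists of copies of gadgets, initial states, and a connection graph on locations; a robot moves freely along connection-graph paths and traverses gadgets according to their states. A gadget $G$ simulates a gadget $H$ if there is a system of copies of $G$ with some of its locations designated as the locations of $H$ and with each state of $H$ corresponding to a configuration of the system, such that, from the configuration corresponding to any state $q$ of $H$, a robot entering the system at a designated location $a$ can exit at a designated location $b$ leaving the system in the configuration corresponding to state $q'$ exactly when $H$ has a transition $(a,b,q')$ in state $q$, and no other behavior is possible; consequently copies of $H$ in any system may be replaced by this construction. -}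

module Defs where

open import Data.Nat using (ℕ)
open import Data.Fin using (Fin; zero; suc)
open import Data.Bool using (Bool; true; false)
open import Data.Product using (Σ; _×_; _,_; proj₁; proj₂)
open import Data.Sum using (_⊎_)
open import Data.Vec using (Vec; lookup; _[_]≔_)
open import Relation.Binary.PropositionalEquality using (_≡_; _≢_)
open import Relation.Nullary using (¬_)
open import Function.Bundles using (_⇔_)

record Gadget : Set where
  field
    nLoc   : ℕ
    nState : ℕ
    trans  : Fin nState → Fin nLoc → Fin nLoc → Fin nState → Bool

  Loc : Set
  Loc = Fin nLoc

  State : Set
  State = Fin nState

  Allowed : State → Loc → Loc → Set
  Allowed s a b = Σ State λ s' → trans s a b s' ≡ true

open Gadget public

Deterministic : Gadget → Set
Deterministic G = ∀ s a b s' b₂ s₂ →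
  trans G s a b s' ≡ true → trans G s a b₂ s₂ ≡ true → (b ≡ b₂) × (s' ≡ s₂)

Reversible : Gadget → Set
Reversible G = ∀ s a b s' → trans G s a b s' ≡ true → trans G s' b a s ≡ true

record KTunnel (k : ℕ) (G : Gadget) : Set where
  field
    tunnelOf : Loc G → Fin k × Fin 2
    endpoint : Fin k → Fin 2 → Loc G
    endpoint-tunnelOf : ∀ x → endpoint (proj₁ (tunnelOf x)) (proj₂ (tunnelOf x)) ≡ x
    tunnelOf-endpoint : ∀ t i → tunnelOf (endpoint t i) ≡ (t , i)
    within-tunnel : ∀ s a b s' → trans G s a b s' ≡ true →
      (proj₁ (tunnelOf a) ≡ proj₁ (tunnelOf b)) × (proj₂ (tunnelOf a) ≢ proj₂ (tunnelOf b))

  tunnel : Loc G → Fin k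
  tunnel x = proj₁ (tunnelOf x)

open KTunnel public

Interacting : ∀ {k G} → KTunnel k G → Set
Interacting {k} {G} T =
  Σ (State G) λ s → Σ (Loc G) λ a → Σ (Loc G) λ b → Σ (State G) λ s' →
  (trans G s a b s' ≡ true) ×
  Σ (Fin k) λ t' → (t' ≢ tunnel T a) ×
  Σ (Fin 2) λ i → Σ (Fin 2) λ j → (i ≢ j) ×
  ¬ (Allowed G s (endpoint T t' i) (endpoint T t' j)
      ⇔ Allowed G s' (endpoint T t' i) (endpoint T t' j))

-- The locking 2-toggle.
-- Locations: a₁ = 0, b₁ = 1, a₂ = 2, b₂ = 3.  States: M = 0, S₁ = 1, S₂ = 2.

l2tTrans : Fin 3 → Fin 4 → Fin 4 → Fin 3 → Bool
l2tTrans zero zero (suc zero) (suc zero) = true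
l2tTrans zero (suc (suc zero)) (suc (suc (suc zero))) (suc (suc zero)) = true
l2tTrans (suc zero) (suc zero) zero zero = true
l2tTrans (suc (suc zero)) (suc (suc (suc zero))) (suc (suc zero)) zero = true
l2tTrans _ _ _ _ = false

Locking2Toggle : Gadget
Locking2Toggle = record { nLoc = 4 ; nState = 3 ; trans = l2tTrans }

record System (G : Gadget) : Set where
  field
    copies : ℕ
    conn   : Fin copies × Loc G → Fin copies × Loc G → Bool

  SLoc : Set
  SLoc = Fin copies × Loc G

  Config : Set
  Config = Vec (State G) copies

  Pos : Set
  Pos = Config × SLoc

  data Step : Pos → Pos → Set where
    move : ∀ {C x y} → (conn x y ≡ true) ⊎ (conn y x ≡ true) → Step (C , x) (C , y)
    traverse : ∀ {C i a b s'} → trans G (lookup C i) a b s' ≡ true →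
               Step (C , (i , a)) (C [ i ]≔ s' , (i , b))

  -- A traversal of the system w.r.t. a set of designated locations:
  -- a nonempty sequence of steps whose intermediate positions are not
  -- designated (the robot has not exited the system in between).
  data Traversal {n : ℕ} (des : Fin n → SLoc) : Pos → Pos → Set where
    one  : ∀ {p q} → Step p q → Traversal des p q
    more : ∀ {p r q} → Step p r → (∀ h → des h ≢ proj₂ r) →
           Traversal des r q → Traversal des p q

open System public

record Simulates (G H : Gadget) : Set where
  field
    sys  : System G
    des  : Loc H → SLoc sys
    des-injective : ∀ a b → des a ≡ des b → a ≡ b
    conf : State H → Config sys
    complete : ∀ q a b q' → trans H q a b q' ≡ true →
      Traversal sys des (conf q , des a) (conf q' , des b)
    sound : ∀ q a b C → Traversal sys des (conf q , des a) (C , des b) →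
      (Σ (State H) λ q' → (trans H q a b q' ≡ true) × (C ≡ conf q'))
      ⊎ ((a ≡ b) × (C ≡ conf q))

{-# OPTIONS --safe #-}

-- Two tunnels of the gadget act on its states as partial injections f and g, and up
-- to choosing orientations there are states with f(s) = s', g(s) = u and g(s')
-- undefined.  Some word w in f and g has a value w(x) = y at which it is undefined:
-- g⁻¹ if it is undefined at s (x = u, y = s), and otherwise "g, then f" (x = g⁻¹(s),
-- y = s').  Hence w on one copy in state x followed by w⁻¹ on another in state y
-- can only be traversed alternately forwards and backwards.  The locking 2-toggle
-- consists of the tracks
--   w on copy 2, g on copy 1, f on copy 0, w⁻¹ on copy 3,
--   w on copy 4, g on copy 0, f on copy 1, w⁻¹ on copy 5,
-- with copies 0 and 1 initially in state s: traversing a track applies f to the copy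
-- on which the other track needs g.

module Submission where

open import Defs
open import Data.Bool using (true) renaming (_≟_ to _≟ᵇ_)
open import Data.Empty using (⊥-elim)
open import Data.Fin using (Fin; suc; opposite)
open import Data.Fin.Patterns using (0F; 1F; 2F; 3F; 4F; 5F)
open import Data.Fin.Properties using (_≟_; all?; any?; suc-injective; opposite-involutive)
open import Data.List using (List; []; _∷_; _++_; map)
open import Data.List.Properties using (++-identityʳ)
open import Data.Maybe as Maybe using (Maybe; just; nothing)
open import Data.Maybe.Properties as Maybe using (just-injective)
open import Data.Maybe.Relation.Unary.All as All using (All; just)
open import Data.Nat using (ℕ)
open import Data.Product using (∃; ∃₂; _×_; _,_; proj₁; proj₂)
open import Data.Product.Properties using (,-injectiveˡ; ,-injectiveʳ; ≡-dec)
open import Data.Sum using (_⊎_; inj₁; inj₂)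
open import Data.Unit using (tt)
open import Data.Vec using (Vec; []; _∷_; lookup; _[_]≔_)
open import Data.Vec.Properties using (lookup∘update; []≔-idempotent; []≔-lookup)
open import Function using (_∘_)
open import Function.Bundles using (_⇔_; mk⇔)
open import Relation.Binary.Definitions using (DecidableEquality)
open import Relation.Binary.PropositionalEquality
  using (_≡_; _≢_; refl; sym; cong; cong₂; subst)
  renaming (trans to ≡-trans)
open import Relation.Nullary using (¬_; Dec; yes; no; does)
open import Relation.Nullary.Decidable using (toWitness; dec-true; _×-dec_; _→-dec_)

-- Ports, connections and routes

private
  variable
    n : ℕ

does⇒ : ∀ {P : Set} (P? : Dec P) → does P? ≡ true → P
does⇒ (yes p) _ = p

-- (t , e) is end e of tunnel t; only two tunnels of the gadget are used.
End : Set
End = Fin 2 × Fin 2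

flip : End → End
flip (t , e) = t , opposite e

flip-involutive : ∀ e → flip (flip e) ≡ e
flip-involutive (t , e) = cong (t ,_) (opposite-involutive e)

Port : ℕ → Set
Port n = Fin n × End

opp : Port n → Port n
opp (i , e) = i , flip e

_≟ᵖ_ : DecidableEquality (Port n)
_≟ᵖ_ = ≡-dec _≟_ (≡-dec _≟_ _≟_)

Mating : ℕ → Set
Mating n = Port n → Maybe (Port n)

-- Quantifying over the components separately lets `all?` decide this by enumeration.
Involutive : Mating n → Set
Involutive mate = ∀ i t e → All (λ q → mate q ≡ just (i , t , e)) (mate (i , t , e))

involutive? : (mate : Mating n) → Dec (Involutive mate)
involutive? mate = all? λ i → all? λ t → all? λ e →
  All.dec (λ q → Maybe.≡-dec _≟ᵖ_ (mate q) (just (i , t , e))) (mate (i , t , e))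

-- A list of ports stands for the tunnel traversals entered at these ports, while
-- the last argument of Route is the port at which the route is left.
data Route (mate : Mating n) : Port n → List (Port n) → Port n → Set where
  last : ∀ {p} → mate (opp p) ≡ nothing → Route mate p (p ∷ []) (opp p)
  link : ∀ {p q ps z} → mate (opp p) ≡ just q → Route mate q ps z → Route mate p (p ∷ ps) z

links : List (Port n) → List (Port n × Port n)
links (p ∷ q ∷ ps) = (opp p , q) ∷ links (q ∷ ps)
links _            = []

-- The first matching pair wins, so a list that uses a port twice need not give an involution;
-- `Layout` therefore asks for `Involutive`.
matingOf : List (Port n × Port n) → Mating n
matingOf [] p = nothing
matingOf ((a , b) ∷ ls) p with p ≟ᵖ a | p ≟ᵖ b
... | yes _ | _     = just b
... | no  _ | yes _ = just a
... | no  _ | no  _ = matingOf ls p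

-- Functional form of the locking 2-toggle

l2tNext : Fin 3 → Fin 4 → Maybe (Fin 3)
l2tNext 0F 0F = just 1F
l2tNext 0F 2F = just 2F
l2tNext 1F 1F = just 0F
l2tNext 2F 3F = just 0F
l2tNext _  _  = nothing

l2tFar : Fin 4 → Fin 4
l2tFar 0F = 1F
l2tFar 1F = 0F
l2tFar 2F = 3F
l2tFar 3F = 2F

l2t-complete : ∀ q a b q' → l2tTrans q a b q' ≡ true → b ≡ l2tFar a × l2tNext q a ≡ just q'
l2t-complete = toWitness {a? = all? λ q → all? λ a → all? λ b → all? λ q' →
  (l2tTrans q a b q' ≟ᵇ true) →-dec
  ((b ≟ l2tFar a) ×-dec Maybe.≡-dec _≟_ (l2tNext q a) (just q'))} tt

l2t-sound : ∀ q a q' → l2tNext q a ≡ just q' → l2tTrans q a (l2tFar a) q' ≡ true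
l2t-sound = toWitness {a? = all? λ q → all? λ a → all? λ q' →
  Maybe.≡-dec _≟_ (l2tNext q a) (just q') →-dec (l2tTrans q a (l2tFar a) q' ≟ᵇ true)} tt

-- The two tracks

pattern f⁺ = 0F , 0F
pattern f⁻ = 0F , 1F
pattern g⁺ = 1F , 0F
pattern g⁻ = 1F , 1F

module Tracks (w w⁻ : List End) (e₀ : End) where

  -- The last exit of `w⁻` is the first entrance of `w`, so the same end `e₀` serves for entering
  -- and for leaving.
  designated : Fin 4 → Port 6
  designated h = suc (suc h) , e₀

  guarded : Fin 6 → Fin 6 → List (Port 6) → List (Port 6)
  guarded i j ps = map (i ,_) w ++ ps ++ map (j ,_) w⁻

  track : Fin 4 → List (Port 6)
  track 0F = guarded 2F 3F ((1F , g⁺) ∷ (0F , f⁺) ∷ [])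
  track 1F = guarded 3F 2F ((0F , f⁻) ∷ (1F , g⁻) ∷ [])
  track 2F = guarded 4F 5F ((0F , g⁺) ∷ (1F , f⁺) ∷ [])
  track 3F = guarded 5F 4F ((1F , f⁻) ∷ (0F , g⁻) ∷ [])

  -- Tracks `1F` and `3F` are tracks `0F` and `2F` backwards and so use the same links.
  mating : Mating 6
  mating = matingOf (links (track 0F) ++ links (track 2F))

  record Layout : Set where
    field
      involutive : Involutive mating
      unmated    : ∀ h → mating (designated h) ≡ nothing
      route      : ∀ h → Route mating (designated h) (track h) (designated (l2tFar h))

gLayout : Tracks.Layout (g⁻ ∷ []) (g⁺ ∷ []) g⁻
gLayout = record
  { involutive = toWitness {a? = involutive? _} tt
  ; unmated    = λ { 0F → refl ; 1F → refl ; 2F → refl ; 3F → refl }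
  ; route      = λ where
      0F → link refl (link refl (link refl (last refl)))
      1F → link refl (link refl (link refl (last refl)))
      2F → link refl (link refl (link refl (last refl)))
      3F → link refl (link refl (link refl (last refl)))
  }

fgLayout : Tracks.Layout (g⁺ ∷ f⁺ ∷ []) (f⁻ ∷ g⁻ ∷ []) g⁺
fgLayout = record
  { involutive = toWitness {a? = involutive? _} tt
  ; unmated    = λ { 0F → refl ; 1F → refl ; 2F → refl ; 3F → refl }
  ; route      = λ where
      0F → link refl (link refl (link refl (link refl (link refl (last refl)))))
      1F → link refl (link refl (link refl (link refl (link refl (last refl)))))
      2F → link refl (link refl (link refl (link refl (link refl (last refl)))))
      3F → link refl (link refl (link refl (link refl (link refl (last refl)))))
  }

-- Paths in one copy and runs in several copies

module Tunnels
  (G : Gadget) (reversible : Reversible G) (deterministic : Deterministic G)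
  (ℓ : End → Loc G) (ℓ-injective : ∀ {d e} → ℓ d ≡ ℓ e → d ≡ e)
  (ℓ-tunnel : ∀ {s} e {b s'} → trans G s (ℓ e) b s' ≡ true → b ≡ ℓ (flip e))
  where

  Cross : State G → End → State G → Set
  Cross s e s' = trans G s (ℓ e) (ℓ (flip e)) s' ≡ true

  Blocked : State G → End → Set
  Blocked s e = ∀ s' → ¬ Cross s e s'

  cross-unique : ∀ {s e s' s''} → Cross s e s' → Cross s e s'' → s' ≡ s''
  cross-unique c c' = proj₂ (deterministic _ _ _ _ _ _ c c')

  cross-reverse : ∀ {s e s'} → Cross s e s' → Cross s' (flip e) s
  cross-reverse {s} {e} {s'} c = subst (λ d → trans G s' (ℓ (flip e)) (ℓ d) s ≡ true)
    (sym (flip-involutive e)) (reversible _ _ _ _ c)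

  cross? : ∀ s e → Dec (∃ (Cross s e))
  cross? s e = any? λ s' → trans G s (ℓ e) (ℓ (flip e)) s' ≟ᵇ true

  -- The result is nothing when the robot gets blocked on the way.
  data Path : State G → List End → Maybe (State G) → Set where
    done  : ∀ {s} → Path s [] (just s)
    cross : ∀ {s e s' es r} → Cross s e s' → Path s' es r → Path s (e ∷ es) r
    block : ∀ {s e es} → Blocked s e → Path s (e ∷ es) nothing

  Conf : ℕ → Set
  Conf n = Vec (State G) n

  data Run : Conf n → List (Port n) → Maybe (Conf n) → Set where
    done  : ∀ {C : Conf n} → Run C [] (just C)
    cross : ∀ {C : Conf n} {i e s' ps r} → Cross (lookup C i) e s' →
            Run (C [ i ]≔ s') ps r → Run C ((i , e) ∷ ps) r
    block : ∀ {C : Conf n} {i e ps} → Blocked (lookup C i) e → Run C ((i , e) ∷ ps) nothing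

  run-path : ∀ (C : Conf n) i {es s ps r} → Path (lookup C i) es (just s) →
             Run (C [ i ]≔ s) ps r → Run C (map (i ,_) es ++ ps) r
  run-path C i done        R = subst (λ D → Run D _ _) ([]≔-lookup C i) R
  run-path C i (cross {s' = s'} c π) R = cross c (run-path (C [ i ]≔ s') i
    (subst (λ s → Path s _ _) (sym (lookup∘update i C s')) π)
    (subst (λ D → Run D _ _) (sym ([]≔-idempotent C i)) R))

  run-path-end : ∀ (C : Conf n) i {es s} → Path (lookup C i) es (just s) →
                 Run C (map (i ,_) es) (just (C [ i ]≔ s))
  run-path-end C i {s = s} π =
    subst (λ ps → Run C ps (just (C [ i ]≔ s))) (++-identityʳ _) (run-path C i π done)

  run-blocked : ∀ (C : Conf n) i {es ps} → Path (lookup C i) es nothing →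
                Run C (map (i ,_) es ++ ps) nothing
  run-blocked C i (cross {s' = s'} c π) = cross c (run-blocked (C [ i ]≔ s') i
    (subst (λ s → Path s _ _) (sym (lookup∘update i C s')) π))
  run-blocked C i (block b) = block b

  -- Systems connected by a matching

  module Wiring (mate : Mating n) (involutive : Involutive mate) where

    mate-sym : ∀ {p q} → mate p ≡ just q → mate q ≡ just p
    mate-sym {i , t , e} eq with just eq' ← subst (All _) eq (involutive i t e) = eq'

    emb : Port n → Fin n × Loc G
    emb (i , e) = i , ℓ e

    emb-injective : ∀ {p q} → emb p ≡ emb q → p ≡ q
    emb-injective eq = cong₂ _,_ (,-injectiveˡ eq) (ℓ-injective (,-injectiveʳ eq))

    -- A location outside the image of `ℓ` is an end of no port and stays unconnected.
    Wired : Fin n × Loc G → Fin n × Loc G → Set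
    Wired (i , a) y = ∃₂ λ t e → a ≡ ℓ (t , e) × Maybe.map emb (mate (i , t , e)) ≡ just y

    wired? : ∀ x y → Dec (Wired x y)
    wired? (i , a) y = any? λ t → any? λ e → (a ≟ ℓ (t , e)) ×-dec
      Maybe.≡-dec (≡-dec _≟_ _≟_) (Maybe.map emb (mate (i , t , e))) (just y)

    wired-ends : ∀ {x y} → Wired x y → ∃₂ λ p q → x ≡ emb p × y ≡ emb q × mate p ≡ just q
    wired-ends {i , a} (t , e , a≡ , y≡) with mate (i , t , e) in eq
    ... | just q = (i , t , e) , q , cong (i ,_) a≡ , sym (just-injective y≡) , eq

    system : System G
    system = record { copies = n ; conn = λ x y → does (wired? x y) }

    Moves : Fin n × Loc G → Fin n × Loc G → Set
    Moves x y = conn system x y ≡ true ⊎ conn system y x ≡ true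

    move-ends : ∀ {x y} → Moves x y → ∃₂ λ p q → x ≡ emb p × y ≡ emb q × mate p ≡ just q
    move-ends {x} {y} (inj₁ w) = wired-ends (does⇒ (wired? x y) w)
    move-ends {x} {y} (inj₂ w) with q , p , y≡ , x≡ , m ← wired-ends (does⇒ (wired? y x) w) =
      p , q , x≡ , y≡ , mate-sym m

    move-from : ∀ {p y} → Moves (emb p) y → ∃ λ q → y ≡ emb q × mate p ≡ just q
    move-from {p} w with p' , q , p≡ , y≡ , m ← move-ends w =
      q , y≡ , ≡-trans (cong mate (emb-injective p≡)) m

    mate-moves : ∀ {p q} → mate p ≡ just q → Moves (emb p) (emb q)
    mate-moves {p@(i , t , e)} {q} m = inj₁ (dec-true (wired? (emb p) (emb q))
      (t , e , refl , cong (Maybe.map emb) m))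

    -- Since connections form a matching, the robot can only advance along its
    -- route or backtrack.  Enter C p and Exit C p say that it has got to the start
    -- or to the end of the traversal entered at p.
    mutual
      data Enter (C₀ : Conf n) (p₀ : Port n) : Conf n → Port n → Set where
        start : Enter C₀ p₀ C₀ p₀
        walk  : ∀ {C p q} → Exit C₀ p₀ C p → mate (opp p) ≡ just q → Enter C₀ p₀ C q

      data Exit (C₀ : Conf n) (p₀ : Port n) : Conf n → Port n → Set where
        cross : ∀ {C i e s'} → Enter C₀ p₀ C (i , e) → Cross (lookup C i) e s' →
                Exit C₀ p₀ (C [ i ]≔ s') (i , e)

    data Visited (C₀ : Conf n) (p₀ : Port n) : Conf n × (Fin n × Loc G) → Set where
      enter : ∀ {C p x} → x ≡ emb p → Enter C₀ p₀ C p → Visited C₀ p₀ (C , x)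
      exit  : ∀ {C p x} → x ≡ emb (opp p) → Exit C₀ p₀ C p → Visited C₀ p₀ (C , x)

    module _ {C₀ : Conf n} {p₀ : Port n} (unmated : mate p₀ ≡ nothing) where

      -- By reversibility the way back is a transition, and by determinism it is the only one from
      -- there; it restores the configuration before the crossing.
      uncross : ∀ {C i e b s''} → Exit C₀ p₀ C (i , e) →
        trans G (lookup C i) (ℓ (flip e)) b s'' ≡ true →
        Visited C₀ p₀ (C [ i ]≔ s'' , (i , b))
      uncross {i = i} {e} {b} {s''} (cross {C} {s' = s'} E c) t
        rewrite lookup∘update i C s'
        with refl , refl ← deterministic _ _ _ _ _ _ (reversible _ _ _ _ c) t
        rewrite []≔-idempotent {x = s'} {y = lookup C i} C i | []≔-lookup C i = enter refl E

      visited-step : ∀ {P Q} → Visited C₀ p₀ P → Step system P Q → Visited C₀ p₀ Q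
      visited-step (enter {p = p} refl E) (traverse t)
        with refl ← ℓ-tunnel (proj₂ p) t = exit refl (cross E t)
      visited-step (exit refl X) (traverse t) = uncross X t
      -- The starting port is unmated, so no connection leads away from it.
      visited-step (enter refl start) (move w)
        with q , refl , m ← move-from w with () ← ≡-trans (sym unmated) m
      -- The only connection is the one just used, which leads back to the previous exit.
      visited-step (enter refl (walk X m')) (move w)
        with q , refl , m ← move-from w
        with refl ← just-injective (≡-trans (sym (mate-sym m')) m) = exit refl X
      visited-step (exit refl X) (move w)
        with q , refl , m ← move-from w = enter refl (walk X m)

      visited-traversal : ∀ {k} {des : Fin k → _} {P Q} →
        Visited C₀ p₀ P → Traversal system des P Q → Visited C₀ p₀ Q
      visited-traversal V (one σ)      = visited-step V σ
      visited-traversal V (more σ _ τ) = visited-traversal (visited-step V σ) τ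

    module _ {C₀ : Conf n} {p₀ z : Port n} {ps₀ : List (Port n)} {r : Maybe (Conf n)}
      (route : Route mate p₀ ps₀ z) (run : Run C₀ ps₀ r) where

      mutual
        -- Invariant: from every entrance reached, a suffix of the route and of the run remains.
        -- Determinism identifies each crossing of the robot with the one in the run, and a blocked
        -- run admits none.
        enter-run : ∀ {C p} → Enter C₀ p₀ C p → ∃ λ ps → Route mate p ps z × Run C ps r
        enter-run start = _ , route , run
        enter-run (walk X m) with exit-run X
        ... | inj₁ (m' , _) with () ← ≡-trans (sym m) m'
        ... | inj₂ (q , ps , m' , ρ , R) with refl ← just-injective (≡-trans (sym m) m') = ps , ρ , R

        exit-run : ∀ {C p} → Exit C₀ p₀ C p →
          (mate (opp p) ≡ nothing × opp p ≡ z × r ≡ just C) ⊎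
          (∃₂ λ q ps → mate (opp p) ≡ just q × Route mate q ps z × Run C ps r)
        exit-run (cross E c) with enter-run E
        ... | _ , last m   , cross c' done with refl ← cross-unique c c' = inj₁ (m , refl , refl)
        ... | _ , link m ρ , cross c' R with refl ← cross-unique c c' = inj₂ (_ , _ , m , ρ , R)
        ... | _ , last _   , block b = ⊥-elim (b _ c)
        ... | _ , link _ _ , block b = ⊥-elim (b _ c)

      -- Inner ports of the route are mated, so only its two ends qualify: the start in the initial
      -- configuration, or `z` after a completed run.
      visited-unmated : ∀ {C q} → mate q ≡ nothing → Visited C₀ p₀ (C , emb q) →
        (p₀ ≡ q × C ≡ C₀) ⊎ (z ≡ q × r ≡ just C)
      visited-unmated u (enter eq E) with refl ← emb-injective eq with E
      ... | start    = inj₁ (refl , refl)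
      ... | walk _ m with () ← ≡-trans (sym u) (mate-sym m)
      visited-unmated u (exit eq X) with refl ← emb-injective eq with exit-run X
      ... | inj₁ (_ , z≡ , r≡) = inj₂ (sym z≡ , r≡)
      ... | inj₂ (_ , _ , m , _) with () ← ≡-trans (sym u) m

    run-traversal : ∀ {k} (des : Fin k → Port n) → (∀ h → mate (des h) ≡ nothing) →
      ∀ {C C' p ps z} → Route mate p ps z → Run C ps (just C') →
      Traversal system (emb ∘ des) (C , emb p) (C' , emb z)
    run-traversal des u (last _)   (cross c done) = one (traverse c)
    run-traversal des u (link m ρ) (cross c R) =
      more (traverse c) (mated m) (more (move (mate-moves m)) (mated (mate-sym m))
        (run-traversal des u ρ R))
      where
      -- Intermediate positions are mated, hence not designated.
      mated : ∀ {p q} → mate p ≡ just q → ∀ h → emb (des h) ≢ emb p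
      mated m h eq with refl ← emb-injective eq with () ← ≡-trans (sym (u h)) m

  -- Simulation of the locking 2-toggle

  module Construction {w w⁻ : List End} {e₀ : End} (layout : Tracks.Layout w w⁻ e₀)
    {s s' u x y : State G}
    (f : Cross s f⁺ s') (g : Cross s g⁺ u) (g-blocked : Blocked s' g⁺)
    (w-path : Path x w (just y)) (w⁻-path : Path y w⁻ (just x)) (w-blocked : Path y w nothing)
    where

    open Tracks w w⁻ e₀
    open Layout layout
    open Wiring mating involutive

    -- Copies `2F`, `3F` and copies `4F`, `5F` guard one track each; swapping `x` and `y` in a pair
    -- switches the direction in which its track is open.
    config : Fin 3 → Conf 6
    config 0F = s  ∷ s  ∷ x ∷ y ∷ x ∷ y ∷ []
    config 1F = s' ∷ u  ∷ y ∷ x ∷ x ∷ y ∷ []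
    config 2F = u  ∷ s' ∷ x ∷ y ∷ y ∷ x ∷ []

    run : ∀ q h → Run (config q) (track h) (Maybe.map config (l2tNext q h))
    run 0F 0F = run-path _ 2F w-path (cross g (cross f (run-path-end _ 3F w⁻-path)))
    run 0F 1F = run-blocked _ 3F w-blocked
    run 0F 2F = run-path _ 4F w-path (cross g (cross f (run-path-end _ 5F w⁻-path)))
    run 0F 3F = run-blocked _ 5F w-blocked
    run 1F 0F = run-blocked _ 2F w-blocked
    run 1F 1F = run-path _ 3F w-path
      (cross (cross-reverse f) (cross (cross-reverse g) (run-path-end _ 2F w⁻-path)))
    -- The guard lets the robot in, but copy `0F` is in state `s'` and stops it at `g⁺`. In
    -- `run 2F 0F` copy `1F` does the same.
    run 1F 2F = run-path _ 4F w-path (block g-blocked)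
    run 1F 3F = run-blocked _ 5F w-blocked
    run 2F 0F = run-path _ 2F w-path (block g-blocked)
    run 2F 1F = run-blocked _ 3F w-blocked
    run 2F 2F = run-blocked _ 4F w-blocked
    run 2F 3F = run-path _ 5F w-path
      (cross (cross-reverse f) (cross (cross-reverse g) (run-path-end _ 4F w⁻-path)))

    designated-injective : ∀ {a b} → designated a ≡ designated b → a ≡ b
    designated-injective = suc-injective ∘ suc-injective ∘ ,-injectiveˡ

    simulation : Simulates G Locking2Toggle
    simulation = record
      { sys           = system
      ; des           = emb ∘ designated
      ; des-injective = λ _ _ → designated-injective ∘ emb-injective
      ; conf          = config
      ; complete      = complete
      ; sound         = sound
      }
      where
      Crossing : Conf 6 → Fin 4 → Conf 6 → Fin 4 → Set
      Crossing C a C' b =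
        Traversal system (emb ∘ designated) (C , emb (designated a)) (C' , emb (designated b))

      complete : ∀ q a b q' → l2tTrans q a b q' ≡ true → Crossing (config q) a (config q') b
      complete q a b q' t with refl , next ← l2t-complete q a b q' t =
        run-traversal designated unmated (route a)
          (subst (Run _ _) (cong (Maybe.map config) next) (run q a))

      sound : ∀ q a b C → Crossing (config q) a C b →
        (∃ λ q' → l2tTrans q a b q' ≡ true × C ≡ config q') ⊎ (a ≡ b × C ≡ config q)
      sound q a b C τ
        with visited-unmated (route a) (run q a) (unmated b)
               (visited-traversal (unmated a) (enter refl start) τ)
      ... | inj₁ (a≡b , C≡) = inj₂ (designated-injective a≡b , C≡)
      ... | inj₂ (z≡b , r≡)
        with refl ← designated-injective z≡b
        -- If `l2tNext q a` were `nothing`, the run would be blocked and `r≡` would equate `nothing`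
        -- with `just C`.
        with just q' ← l2tNext q a in next =
          inj₁ (q' , l2t-sound q a q' next , sym (just-injective r≡))

  -- In either case the guard word is stopped at its first letter in its own final state: `g⁺` at
  -- `s'` by hypothesis, or `g⁻` at `s` by the failure of `cross?`.
  simulates : ∀ {s s' u} → Cross s f⁺ s' → Cross s g⁺ u → Blocked s' g⁺ →
              Simulates G Locking2Toggle
  simulates {s} f g b with cross? s g⁻
  ... | yes (_ , h) = Construction.simulation fgLayout f g b
          (cross (cross-reverse h) (cross f done))
          (cross (cross-reverse f) (cross h done))
          (block b)
  ... | no ¬h = Construction.simulation gLayout f g b
          (cross (cross-reverse g) done) (cross g done) (block λ v c → ¬h (v , c))

-- Orienting the two interacting tunnels

endOf : Fin 2 → Fin 2 → Fin 2
endOf o 0F = o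
endOf o 1F = opposite o

≢⇒opposite : ∀ {i j : Fin 2} → i ≢ j → j ≡ opposite i
≢⇒opposite {0F} {0F} i≢j = ⊥-elim (i≢j refl)
≢⇒opposite {0F} {1F} _   = refl
≢⇒opposite {1F} {0F} _   = refl
≢⇒opposite {1F} {1F} i≢j = ⊥-elim (i≢j refl)

endOf-injective : ∀ o {d e} → endOf o d ≡ endOf o e → d ≡ e
endOf-injective o  {0F} {0F} _ = refl
endOf-injective 0F {0F} {1F} ()
endOf-injective 1F {0F} {1F} ()
endOf-injective 0F {1F} {0F} ()
endOf-injective 1F {1F} {0F} ()
endOf-injective o  {1F} {1F} _ = refl

endOf-opposite : ∀ o e → endOf o (opposite e) ≡ opposite (endOf o e)
endOf-opposite o 0F = refl
endOf-opposite o 1F = sym (opposite-involutive o)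

module _ {k : ℕ} {G : Gadget} (T : KTunnel k G)
  (reversible : Reversible G) (deterministic : Deterministic G) where

  endpoint-injective : ∀ {t i t' i'} → endpoint T t i ≡ endpoint T t' i' → (t , i) ≡ (t' , i')
  endpoint-injective eq = ≡-trans (sym (tunnelOf-endpoint T _ _))
    (≡-trans (cong (tunnelOf T) eq) (tunnelOf-endpoint T _ _))

  traversal-end : ∀ {s t i b s'} → trans G s (endpoint T t i) b s' ≡ true →
                  b ≡ endpoint T t (opposite i)
  traversal-end {t = t} {i} {b} tr
    with same , differ ← within-tunnel T _ _ _ _ tr
    rewrite tunnelOf-endpoint T t i =
    ≡-trans (sym (endpoint-tunnelOf T b))
      (cong₂ (endpoint T) (sym same) (≢⇒opposite differ))

  blocking-simulates : ∀ {s s' u t t' i i'} → t ≢ t' →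
    trans G s (endpoint T t i) (endpoint T t (opposite i)) s' ≡ true →
    trans G s (endpoint T t' i') (endpoint T t' (opposite i')) u ≡ true →
    ¬ Allowed G s' (endpoint T t' i') (endpoint T t' (opposite i')) →
    Simulates G Locking2Toggle
  blocking-simulates {t = t} {t'} {i} {i'} t≢t' f g b =
    Tunnels.simulates G reversible deterministic ℓ ℓ-injective ℓ-tunnel f g (λ v c → b (v , c))
    where
    tunnelAt : Fin 2 → Fin k
    tunnelAt 0F = t
    tunnelAt 1F = t'

    tunnelAt-injective : ∀ {c d} → tunnelAt c ≡ tunnelAt d → c ≡ d
    tunnelAt-injective {0F} {0F} _  = refl
    tunnelAt-injective {0F} {1F} eq = ⊥-elim (t≢t' eq)
    tunnelAt-injective {1F} {0F} eq = ⊥-elim (t≢t' (sym eq))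
    tunnelAt-injective {1F} {1F} _  = refl

    -- With these origins the two given transitions become crossings of `f⁺` and `g⁺`.
    originAt : Fin 2 → Fin 2
    originAt 0F = i
    originAt 1F = i'

    ℓ : End → Loc G
    ℓ (c , e) = endpoint T (tunnelAt c) (endOf (originAt c) e)

    ℓ-injective : ∀ {d e} → ℓ d ≡ ℓ e → d ≡ e
    ℓ-injective {c , d} {c' , e} eq
      with eqs ← endpoint-injective eq
      with refl ← tunnelAt-injective {c} {c'} (,-injectiveˡ eqs)
      with refl ← endOf-injective (originAt c) {d} {e} (cong proj₂ eqs) = refl

    ℓ-tunnel : ∀ {s} e {b s'} → trans G s (ℓ e) b s' ≡ true → b ≡ ℓ (flip e)
    ℓ-tunnel (c , e) tr = ≡-trans (traversal-end tr)
      (cong (endpoint T (tunnelAt c)) (sym (endOf-opposite (originAt c) e)))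

  allowed? : ∀ s a b → Dec (Allowed G s a b)
  allowed? s a b = any? λ s' → trans G s a b s' ≟ᵇ true

  endpoint-interacting-simulates : ∀ {s t o s' t' i} → t' ≢ t →
    trans G s (endpoint T t o) (endpoint T t (opposite o)) s' ≡ true →
    ¬ (Allowed G s (endpoint T t' i) (endpoint T t' (opposite i))
        ⇔ Allowed G s' (endpoint T t' i) (endpoint T t' (opposite i))) →
    Simulates G Locking2Toggle
  endpoint-interacting-simulates {s} {t} {o} {s'} {t'} {i} t'≢t tr changes
    with allowed? s (endpoint T t' i) (endpoint T t' (opposite i))
       | allowed? s' (endpoint T t' i) (endpoint T t' (opposite i))
  ... | yes p       | yes q       = ⊥-elim (changes (mk⇔ (λ _ → q) (λ _ → p)))
  ... | no ¬p       | no ¬q       = ⊥-elim (changes (mk⇔ (⊥-elim ∘ ¬p) (⊥-elim ∘ ¬q)))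
  ... | yes (_ , g) | no ¬q       = blocking-simulates (t'≢t ∘ sym) tr g ¬q
  -- The traversal is allowed only in `s'`, so the reverse transition from `s'` to `s` is the one
  -- that blocks it.
  ... | no ¬p       | yes (_ , g) = blocking-simulates (t'≢t ∘ sym)
    (subst (λ j → trans G s' (endpoint T t (opposite o)) (endpoint T t j) s ≡ true)
      (sym (opposite-involutive o)) (reversible _ _ _ _ tr))
    g ¬p

theorem2p3 : (k : ℕ) (G : Gadget) (T : KTunnel k G) →
    Reversible G → Deterministic G → Interacting T →
    Simulates G Locking2Toggle
theorem2p3 k G T reversible deterministic
  (s , a , b , s' , tr , t' , t'≢t , i , j , i≢j , changes)
  with refl ← ≢⇒opposite i≢j =
  endpoint-interacting-simulates T reversible deterministic t'≢t
    (subst (λ b → trans G s a' b s' ≡ true) (traversal-end T reversible deterministic tr') tr')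
    changes
  where
  -- Writing `a` as an endpoint exposes its tunnel and the direction of the transition.
  a' : Loc G
  a' = endpoint T (proj₁ (tunnelOf T a)) (proj₂ (tunnelOf T a))

  tr' : trans G s a' b s' ≡ true
  tr' = subst (λ a → trans G s a b s' ≡ true) (sym (endpoint-tunnelOf T a)) tr
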